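{- Let $F$ be a one-dimensional tropical fan in $\mathbb{R}^n$ whose rays span $\mathbb{R}^n$. For every gallery class $P$ of $F$ with $k+1\ge2$ rays there exists a $\mathbb{Z}$-linear map $\pi:\mathbb{Z}^n\to\mathbb{Z}^k$ such that $\pi_*(F)$ is (isomorphic to) a one-dimensional Bergman fan in $\mathbb{R}^k$ with respect to the lattice $\mathbb{Z}^k$.
   Context: A one-dimensional tropical fan $F$ in $\mathbb{R}^n$ consists of finitely many distinct rays $\mathbb{R}_+v_1,\dots,\mathbb{R}_+v_q$ (and the origin), with $v_i\in\mathbb{Z}^n$ primitive, together with positive integer weights $\omega_1,\dots,\omega_q$ satisfying the balancing condition $\sum_i\omega_iv_i=0$. The push-forward $\pi_*(F)$ under an integer linear map $\pi$ has as rays the half-lines spanned by the nonzero $\pi(v_i)$; the weight of the ray with primitive generator $u$ is $\sum\omega_im_i$, the sum over all $i$ with $\pi(v_i)=m_iu$, $m_i>0$. A one-dimensional Bergman fan in $\mathbb{R}^k$ ($k\ge1$) is the tropical fan with rays generated by $u_0,u_1,\dots,u_k$, all of weight $1$, where $u_1,\dots,u_k$ is a $\mathbb{Z}$-basis of $\mathbb{Z}^k$ and $u_0=-(u_1+\dots+u_k)$. For $l\in(\mathbb{Z}^n)^\vee$ put $\max(0,l)\cdot F=\sum_i\omega_i\max(0,l(v_i))$. If this equals $1$, the gallery of $F$ over $\max(0,l)$ is the set of rays $\mathbb{R}_+v_i$ of $F$ with $|l(v_i)|=1$; it always consists of exactly two rays. The relation on rays "equal, or together forming a gallery of $F$" is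 an equivalence relation; its equivalence classes are called gallery classes here. -}

module Defs where

open import Algebra.Module.Bundles using (module LeftModule)
open import Algebra.Module.Bundles.Raw using (RawLeftModule)
open import Algebra.Module.Construct.TensorUnit using (leftModule)
open import Algebra.Module.Morphism.Structures using (module LeftModuleMorphisms)
import Algebra.Definitions.RawMonoid as RawMonoidDefs
open import Data.Fin.Base using (Fin; zero; suc)
open import Data.Fin.Subset using (Subset; _∈_)
open import Data.Integer.Base as ℤ using (ℤ; +_; 0ℤ; 1ℤ; ∣_∣)
open import Data.Integer.Divisibility using (_∣_)
open import Data.Integer.Properties using (+-*-ring)
open import Data.Nat.Base as ℕ using (ℕ; suc)
open import Data.Product.Base using (∃; ∃₂; _×_)
open import Data.Rational.Base as ℚ using (ℚ)
open import Data.Sum.Base using (_⊎_)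
open import Data.Vec.Functional using (Vector)
open import Function.Bundles using (_⇔_; _↔_; module Inverse)
open import Level using (0ℓ)
open import Relation.Binary.PropositionalEquality.Core using (_≡_; _≢_; _≗_)
open import Relation.Nullary.Negation.Core using (¬_)

∑ℕ : ∀ {q} → Vector ℕ q → ℕ
∑ℕ = RawMonoidDefs.sum ℕ.+-0-rawMonoid

∑ℤ : ∀ {q} → Vector ℤ q → ℤ
∑ℤ = RawMonoidDefs.sum ℤ.+-0-rawMonoid

∑ℚ : ∀ {q} → Vector ℚ q → ℚ
∑ℚ = RawMonoidDefs.sum ℚ.+-0-rawMonoid

-- The lattice ℤⁿ; vectors are functions, compared pointwise.

ℤ^_ : ℕ → RawLeftModule ℤ 0ℓ 0ℓ
ℤ^ n = record
  { Carrierᴹ = Vector ℤ n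
  ; _≈ᴹ_     = _≗_
  ; _+ᴹ_     = λ v w t → v t ℤ.+ w t
  ; _*ₗ_     = λ a v t → a ℤ.* v t
  ; 0ᴹ       = λ _ → 0ℤ
  ; -ᴹ_      = λ v t → ℤ.- v t
  }

ℤ¹ : RawLeftModule ℤ 0ℓ 0ℓ
ℤ¹ = LeftModule.rawLeftModule (leftModule {R = +-*-ring})

IsLinear : ∀ {n k} → (Vector ℤ n → Vector ℤ k) → Set
IsLinear {n} {k} = LeftModuleMorphisms.IsLeftModuleHomomorphism (ℤ^ n) (ℤ^ k)

IsLinearForm : ∀ {n} → (Vector ℤ n → ℤ) → Set
IsLinearForm {n} = LeftModuleMorphisms.IsLeftModuleHomomorphism (ℤ^ n) ℤ¹

IsZero : ∀ {n} → Vector ℤ n → Set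
IsZero v = ∀ t → v t ≡ 0ℤ

infixr 7 _·_

_·_ : ∀ {n} → ℕ → Vector ℤ n → Vector ℤ n
(m · v) t = + m ℤ.* v t

combination : ∀ {q n} → Vector ℤ q → Vector (Vector ℤ n) q → Vector ℤ n
combination c v t = ∑ℤ (λ i → c i ℤ.* v i t)

-- The zero vector is not Primitive: every d divides it.

Primitive : ∀ {n} → Vector ℤ n → Set
Primitive v = ∀ (d : ℕ) → (∀ t → + d ∣ v t) → d ≡ 1

-- For nonzero v and w: ℝ₊v = ℝ₊w.

SameRay : ∀ {n} → Vector ℤ n → Vector ℤ n → Set
SameRay v w = ∃₂ λ a b → suc a · v ≗ suc b · w

record IsBasis {k} (u : Vector (Vector ℤ k) k) : Set where
  field
    generates   : ∀ x → ∃ λ c → combination c u ≗ x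
    independent : ∀ c → IsZero (combination c u) → IsZero c

record TropicalFan (n : ℕ) : Set where
  field
    size        : ℕ
    generator   : Vector (Vector ℤ n) size
    weight      : Vector ℕ size
    isPrimitive : ∀ i → Primitive (generator i)
    distinct    : ∀ i j → i ≢ j → ¬ SameRay (generator i) (generator j)
    positive    : ∀ i → 0 ℕ.< weight i
    balanced    : IsZero (combination (λ i → + weight i) generator)

open TropicalFan public

-- Spanning is taken over ℚ. For integer vectors this agrees with spanning
-- ℝⁿ over ℝ, as rank does not change under field extension.

Spanning : ∀ {n} → TropicalFan n → Set
Spanning {n} F = ∀ (x : Vector ℚ n) →
  ∃ λ (c : Vector ℚ (size F)) → ∀ t → ∑ℚ (λ i → c i ℚ.* (generator F i t ℚ./ 1)) ≡ x t

-- The contribution of w to the ray of the primitive vector u: the m > 0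
-- with w = m u if there is one, and 0 otherwise.

data Multiplicity {n} (u w : Vector ℤ n) : ℕ → Set where
  on  : ∀ m → w ≗ suc m · u → Multiplicity u w (suc m)
  off : ¬ (∃ λ m → w ≗ suc m · u) → Multiplicity u w 0

-- G = π_*(F). This determines G up to the indexing of its rays.

record IsPushForward {n k} (π : Vector ℤ n → Vector ℤ k)
                     (F : TropicalFan n) (G : TropicalFan k) : Set where
  field
    ray-of-image : ∀ i → ¬ IsZero (π (generator F i)) →
                   ∃ λ j → SameRay (generator G j) (π (generator F i))
    image-of-ray : ∀ j → ∃ λ i → ¬ IsZero (π (generator F i)) ×
                   SameRay (generator G j) (π (generator F i))
    weights      : ∀ j → ∃ λ (m : Vector ℕ (size F)) →
                   (∀ i → Multiplicity (generator G j) (π (generator F i)) (m i)) ×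
                   weight G j ≡ ∑ℕ (λ i → weight F i ℕ.* m i)

-- Since u ranges over all ℤ-bases, being a Bergman fan is invariant under
-- automorphisms of ℤᵏ. Inverse.to index enumerates the rays as u₀, u₁, …, uₖ.

record IsBergmanFan {k} (G : TropicalFan k) : Set where
  field
    dim-positive  : 1 ℕ.≤ k
    u             : Vector (Vector ℤ k) k
    u-basis       : IsBasis u
    index         : Fin (suc k) ↔ Fin (size G)
    generator₀    : generator G (Inverse.to index zero) ≗ (λ t → ℤ.- ∑ℤ (λ i → u i t))
    generatorᵢ    : ∀ i → generator G (Inverse.to index (suc i)) ≗ u i
    unit-weights  : ∀ j → weight G j ≡ 1

-- max(0,l)·F

degree : ∀ {n} → (Vector ℤ n → ℤ) → TropicalFan n → ℤ
degree l F = ∑ℤ (λ i → + weight F i ℤ.* (0ℤ ℤ.⊔ l (generator F i)))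

InGallery : ∀ {n} (F : TropicalFan n) → (Vector ℤ n → ℤ) → Fin (size F) → Set
InGallery F l r = ∣ l (generator F r) ∣ ≡ 1

FormGallery : ∀ {n} (F : TropicalFan n) → Fin (size F) → Fin (size F) → Set
FormGallery F i j = ∃ λ l → IsLinearForm l × degree l F ≡ 1ℤ ×
  (∀ r → InGallery F l r ⇔ (r ≡ i ⊎ r ≡ j))

GalleryRelated : ∀ {n} (F : TropicalFan n) → Fin (size F) → Fin (size F) → Set
GalleryRelated F i j = i ≡ j ⊎ FormGallery F i j

IsGalleryClass : ∀ {n} (F : TropicalFan n) → Subset (size F) → Set
IsGalleryClass F P = ∃ λ i → ∀ j → j ∈ P ⇔ GalleryRelated F i j

{-# OPTIONS --safe #-}
module Submission where

-- If max(0,l)·F = 1 then l is 1 on exactly one ray and −1 on exactly one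
-- other ray, both of weight 1, and it vanishes on all remaining rays: the
-- positive part of ∑ᵢ ωᵢ l(vᵢ) is 1, and balancing forces the negative part
-- to be 1 as well. Fix the base ray i₀ of the class P and choose, for each of
-- the other k rays of P, such a form that is 1 on it and −1 on i₀. These forms
-- are the coordinates of π: it sends the k rays to the standard basis, i₀ to
-- −(1,…,1), and every ray outside P to 0.

open import Defs
open import Data.Nat.Base using (ℕ; suc; _≤_)
open import Data.Integer.Base using (ℤ)
open import Data.Vec.Functional using (Vector)
open import Data.Fin.Subset using (Subset; ∣_∣)
open import Data.Product.Base using (Σ-syntax; _×_)
open import Relation.Binary.PropositionalEquality.Core using (_≡_)

open import Algebra.Bundles using (CommutativeMonoid)
import Algebra.Properties.CommutativeMonoid.Sum as CommutativeMonoidSum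
open import Algebra.Module.Morphism.Structures using (module LeftModuleMorphisms)
open import Data.Bool.Base using (if_then_else_)
open import Data.Fin.Base using (Fin; zero; suc; punchIn; punchOut)
open import Data.Fin.Properties using (_≟_; any?; suc-injective; punchIn-injective; punchInᵢ≢i; punchIn-punchOut)
open import Data.Fin.Subset using (_∈_; inside; outside)
open import Data.Integer.Base as ℤ using (+_; -[1+_]; 0ℤ; 1ℤ; -1ℤ)
import Data.Integer.Properties as ℤ
open import Data.Nat.Base as ℕ using (zero; s≤s; z≤n)
open import Data.Nat.Divisibility using (_∣_; ∣1⇒≡1)
import Data.Nat.Properties as ℕ
open import Data.Product.Base using (∃; ∃₂; _,_; proj₁; proj₂)
open import Data.Sum.Base using (inj₁; inj₂)
open import Data.Vec.Base using ([]; _∷_; here; there)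
open import Function.Base using (_∘_)
open import Function.Bundles using (module Equivalence)
open import Function.Construct.Identity using (↔-id)
open import Function.Definitions using (Injective)
open import Relation.Binary.PropositionalEquality using (_≢_; _≗_; refl; sym; trans; cong; cong₂; subst; module ≡-Reasoning)
open import Relation.Nullary.Decidable using (does; dec-true; dec-false; yes; no)
open import Relation.Nullary.Negation using (¬_; contradiction)

open Equivalence using (to; from)

private
  module ∑ℤ = CommutativeMonoidSum ℤ.+-0-commutativeMonoid

-- Finite sums

module _ {c ℓ} (M : CommutativeMonoid c ℓ) where
  open CommutativeMonoid M using (Carrier; _≈_; _∙_; ε; setoid; ∙-congˡ; identityʳ)
  open CommutativeMonoidSum M
  open import Relation.Binary.Reasoning.Setoid setoid

  -- Stated for any commutative monoid because it is needed twice: over the integers to evaluate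
  -- combinations of `δ`, and over the naturals to evaluate push-forward weights.
  sum-supported-at : ∀ {q} (f : Vector Carrier q) i →
                     (∀ r → r ≢ i → f r ≈ ε) → sum f ≈ f i
  sum-supported-at {suc q} f i f≈ε = begin
    sum f                             ≈⟨ sum-remove f ⟩
    f i ∙ sum (f ∘ punchIn i)         ≈⟨ ∙-congˡ (sum-cong-≋ λ r → f≈ε _ (punchInᵢ≢i i r)) ⟩
    f i ∙ sum {q} (λ _ → ε)           ≈⟨ ∙-congˡ (sum-replicate-zero q) ⟩
    f i ∙ ε                           ≈⟨ identityʳ _ ⟩
    f i                               ∎

∑ℕ≡0⇒≡0 : ∀ {q} (a : Vector ℕ q) → ∑ℕ a ≡ 0 → ∀ i → a i ≡ 0
∑ℕ≡0⇒≡0 a ∑≡0 zero    = ℕ.m+n≡0⇒m≡0 (a zero) ∑≡0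
∑ℕ≡0⇒≡0 a ∑≡0 (suc i) = ∑ℕ≡0⇒≡0 (a ∘ suc) (ℕ.m+n≡0⇒n≡0 (a zero) ∑≡0) i

∑ℕ≡1⇒unit : ∀ {q} (a : Vector ℕ q) → ∑ℕ a ≡ 1 →
            ∃ λ i → a i ≡ 1 × (∀ r → r ≢ i → a r ≡ 0)
-- Only the heads 1 and 0 are compatible with the total: a head of 1 uses it up, so the tail
-- vanishes, and a head of 0 leaves it to the tail.
∑ℕ≡1⇒unit {suc q} a ∑≡1 with a zero in a₀
... | 1 = zero , a₀ , λ where
        zero    0≢0 → contradiction refl 0≢0
        (suc r) _   → ∑ℕ≡0⇒≡0 (a ∘ suc) (ℕ.suc-injective ∑≡1) r
... | 0 with i , aᵢ≡1 , a≡0 ← ∑ℕ≡1⇒unit (a ∘ suc) ∑≡1 = suc i , aᵢ≡1 , λ where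
        zero    _   → a₀
        (suc r) r≢i → a≡0 r (r≢i ∘ cong suc)

∑ℤ-pos : ∀ {q} (a : Vector ℕ q) → ∑ℤ (λ i → + a i) ≡ + ∑ℕ a
∑ℤ-pos {zero}  a = refl
∑ℤ-pos {suc q} a = cong (λ s → + a zero ℤ.+ s) (∑ℤ-pos (a ∘ suc))

-- Linear forms

module _ {n} {l : Vector ℤ n → ℤ} (l-linear : IsLinearForm l) where
  open LeftModuleMorphisms.IsLeftModuleHomomorphism l-linear

  linearForm-combination : ∀ {q} (c : Vector ℤ q) (v : Vector (Vector ℤ n) q) →
                           l (combination c v) ≡ ∑ℤ (λ i → c i ℤ.* l (v i))
  linearForm-combination {zero}  c v = 0ᴹ-homo
  linearForm-combination {suc q} c v = trans (+ᴹ-homo _ _)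
    (cong₂ ℤ._+_ (*ₗ-homo (c zero) (v zero)) (linearForm-combination (c ∘ suc) (v ∘ suc)))

  -- A gallery determines its form only up to sign; negation allows the sign to be chosen so that
  -- the base ray gets the value -1.
  neg-linearForm : IsLinearForm (λ x → ℤ.- l x)
  neg-linearForm = record
    { +ᴹ-isGroupHomomorphism = record
      { isMonoidHomomorphism = record
        { isMagmaHomomorphism = record
          { isRelHomomorphism = record { cong = λ x≗y → cong ℤ.-_ (⟦⟧-cong x≗y) }
          ; homo = λ x y → trans (cong ℤ.-_ (+ᴹ-homo x y)) (ℤ.neg-distrib-+ (l x) (l y))
          }
        ; ε-homo = cong ℤ.-_ 0ᴹ-homo
        }
      ; ⁻¹-homo = λ x → cong ℤ.-_ (-ᴹ-homo x)
      }
    ; *ₗ-homo = λ a x → trans (cong ℤ.-_ (*ₗ-homo a x)) (ℤ.neg-distribʳ-* a (l x))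
    }

linearForms⇒linear : ∀ {n k} (l : Fin k → Vector ℤ n → ℤ) →
                     (∀ a → IsLinearForm (l a)) → IsLinear (λ x a → l a x)
linearForms⇒linear l l-linear = record
  { +ᴹ-isGroupHomomorphism = record
    { isMonoidHomomorphism = record
      { isMagmaHomomorphism = record
        { isRelHomomorphism = record { cong = λ x≗y a → Hom.⟦⟧-cong a x≗y }
        ; homo = λ x y a → Hom.+ᴹ-homo a x y
        }
      ; ε-homo = λ a → Hom.0ᴹ-homo a
      }
    ; ⁻¹-homo = λ x a → Hom.-ᴹ-homo a x
    }
  ; *ₗ-homo = λ c x a → Hom.*ₗ-homo a c x
  }
  where module Hom a = LeftModuleMorphisms.IsLeftModuleHomomorphism (l-linear a)

-- Galleries

positivePart : ℤ → ℕ
positivePart (+ n)    = n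
positivePart -[1+ _ ] = 0

0⊔≡positivePart : ∀ x → 0ℤ ℤ.⊔ x ≡ + positivePart x
0⊔≡positivePart (+ n)    = refl
0⊔≡positivePart -[1+ _ ] = refl

positivePart≡1⇒≡1 : ∀ x → positivePart x ≡ 1 → x ≡ 1ℤ
positivePart≡1⇒≡1 (+ _) refl = refl

positiveParts≡0⇒≡0 : ∀ x → positivePart x ≡ 0 → positivePart (ℤ.- x) ≡ 0 → x ≡ 0ℤ
positiveParts≡0⇒≡0 (+ _)    refl _ = refl
positiveParts≡0⇒≡0 -[1+ _ ] _    ()

-- This is the splitting of x into positive minus negative part, written without subtraction.
0⊔-decompose : ∀ x → 0ℤ ℤ.⊔ x ≡ x ℤ.+ (0ℤ ℤ.⊔ (ℤ.- x))
0⊔-decompose (+ zero)  = refl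
0⊔-decompose (+ suc n) = sym (ℤ.+-identityʳ _)
0⊔-decompose -[1+ n ]  = sym (ℤ.+-inverseˡ (+ suc n))

-- On the ray generators, `l` is the indicator of `p` minus the indicator of `m`. Unlike a gallery,
-- which is an unordered pair, this records which ray has which sign.
record Separates {n} (F : TropicalFan n) (l : Vector ℤ n → ℤ) (p m : Fin (size F)) : Set where
  field
    weight₊ : weight F p ≡ 1
    weight₋ : weight F m ≡ 1
    value₊  : l (generator F p) ≡ 1ℤ
    value₋  : l (generator F m) ≡ -1ℤ
    value₀  : ∀ r → r ≢ p → r ≢ m → l (generator F r) ≡ 0ℤ

module _ {n} (F : TropicalFan n) where
  private
    v = generator F
    ω = weight F

  -- By `0⊔-decompose` the two degrees differ by the weighted sum of the values of `l`, which is `l`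
  -- applied to the balancing sum and hence 0.
  degree-neg : ∀ {l} → IsLinearForm l → degree (λ x → ℤ.- l x) F ≡ degree l F
  degree-neg {l} l-linear = sym (begin
    degree l F
      ≡⟨ ∑ℤ.sum-cong-≗ (λ i → trans (cong (+ ω i ℤ.*_) (0⊔-decompose (l (v i))))
                                    (ℤ.*-distribˡ-+ (+ ω i) (l (v i)) _)) ⟩
    ∑ℤ (λ i → + ω i ℤ.* l (v i) ℤ.+ + ω i ℤ.* (0ℤ ℤ.⊔ (ℤ.- l (v i))))
      ≡⟨ ∑ℤ.∑-distrib-+ (λ i → + ω i ℤ.* l (v i)) _ ⟩
    ∑ℤ (λ i → + ω i ℤ.* l (v i)) ℤ.+ degree (λ x → ℤ.- l x) F
      ≡⟨ cong (ℤ._+ degree (λ x → ℤ.- l x) F) balanced-l ⟩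
    0ℤ ℤ.+ degree (λ x → ℤ.- l x) F
      ≡⟨ ℤ.+-identityˡ _ ⟩
    degree (λ x → ℤ.- l x) F ∎)
    where
    open ≡-Reasoning
    open LeftModuleMorphisms.IsLeftModuleHomomorphism l-linear using (⟦⟧-cong; 0ᴹ-homo)

    balanced-l : ∑ℤ (λ i → + ω i ℤ.* l (v i)) ≡ 0ℤ
    balanced-l = trans (sym (linearForm-combination l-linear (λ i → + ω i) v))
                       (trans (⟦⟧-cong (balanced F)) 0ᴹ-homo)

  -- The degree is a sum of natural numbers, so exactly one summand is 1, with both of its factors
  -- 1. In the vanishing summands the positive weight can be cancelled.
  degree≡1⇒positiveRay : ∀ l → degree l F ≡ 1ℤ →
    ∃ λ p → ω p ≡ 1 × l (v p) ≡ 1ℤ × (∀ r → r ≢ p → positivePart (l (v r)) ≡ 0)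
  degree≡1⇒positiveRay l deg≡1 =
    let p , one , zeros = ∑ℕ≡1⇒unit summand (ℤ.+-injective (trans (sym degree≡) deg≡1))
    in p
     , ℕ.m*n≡1⇒m≡1 (ω p) _ one
     , positivePart≡1⇒≡1 _ (ℕ.m*n≡1⇒n≡1 (ω p) _ one)
     , λ r r≢p → ℕ.m*n≡0⇒m≡0 _ (ω r) {{ℕ.>-nonZero (positive F r)}}
                   (trans (ℕ.*-comm _ (ω r)) (zeros r r≢p))
    where
    summand : Vector ℕ (size F)
    summand i = ω i ℕ.* positivePart (l (v i))

    degree≡ : degree l F ≡ + ∑ℕ summand
    degree≡ = trans
      (∑ℤ.sum-cong-≗ λ i → trans (cong (+ ω i ℤ.*_) (0⊔≡positivePart (l (v i))))
                                 (sym (ℤ.pos-* (ω i) _)))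
      (∑ℤ-pos summand)

  -- Since `l` and its negative both have degree 1, each singles out one ray. On any further ray the
  -- positive and the negative part of `l` both vanish.
  degree≡1⇒separates : ∀ {l} → IsLinearForm l → degree l F ≡ 1ℤ → ∃₂ (Separates F l)
  degree≡1⇒separates {l} l-linear deg≡1
    with p , ωₚ , lₚ , zeros₊ ← degree≡1⇒positiveRay l deg≡1
       | m , ωₘ , lₘ , zeros₋ ← degree≡1⇒positiveRay (λ x → ℤ.- l x) (trans (degree-neg l-linear) deg≡1)
    = p , m , record
    { weight₊ = ωₚ
    ; weight₋ = ωₘ
    ; value₊  = lₚ
    ; value₋  = ℤ.neg-injective lₘ
    ; value₀  = λ r r≢p r≢m → positiveParts≡0⇒≡0 _ (zeros₊ r r≢p) (zeros₋ r r≢m)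
    }

  separates-neg : ∀ {l p m} → Separates F l p m → Separates F (λ x → ℤ.- l x) m p
  separates-neg S = record
    { weight₊ = weight₋
    ; weight₋ = weight₊
    ; value₊  = cong ℤ.-_ value₋
    ; value₋  = cong ℤ.-_ value₊
    ; value₀  = λ r r≢m r≢p → cong ℤ.-_ (value₀ r r≢p r≢m)
    }
    where open Separates S

  separates⇒≢ : ∀ {l p m} → Separates F l p m → p ≢ m
  separates⇒≢ S refl with () ← trans (sym (Separates.value₊ S)) (Separates.value₋ S)

  gallery⇒separates : ∀ {i j} → FormGallery F i j →
                      ∃ λ l → IsLinearForm l × Separates F l j i
  gallery⇒separates (l , l-linear , deg≡1 , inGallery)
    with p , m , S ← degree≡1⇒separates l-linear deg≡1
    -- Both `p` and `m` lie in the gallery and they differ, so they are `i` and `j` in some order;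
    -- if `p` is `i`, the form is negated.
    with to (inGallery p) (cong ℤ.∣_∣ (Separates.value₊ S))
       | to (inGallery m) (cong ℤ.∣_∣ (Separates.value₋ S))
  ... | inj₁ refl | inj₁ refl = contradiction refl (separates⇒≢ S)
  ... | inj₁ refl | inj₂ refl = _ , neg-linearForm l-linear , separates-neg S
  ... | inj₂ refl | inj₁ refl = l , l-linear , S
  ... | inj₂ refl | inj₂ refl = contradiction refl (separates⇒≢ S)

-- Enumerating a subset

record Enumeration {q} (P : Subset q) (k : ℕ) : Set where
  field
    elem      : Fin k → Fin q
    injective : Injective _≡_ _≡_ elem
    sound     : ∀ a → elem a ∈ P
    complete  : ∀ {i} → i ∈ P → ∃ λ a → elem a ≡ i

enumerate : ∀ {q} (P : Subset q) → Enumeration P ∣ P ∣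
enumerate [] = record
  { elem = λ () ; injective = λ { {()} } ; sound = λ () ; complete = λ () }
enumerate (outside ∷ P) = record
  { elem      = suc ∘ elem
  ; injective = injective ∘ suc-injective
  ; sound     = there ∘ sound
  ; complete  = λ { (there i∈P) → let a , eq = complete i∈P in a , cong suc eq }
  }
  where open Enumeration (enumerate P)
enumerate (inside ∷ P) = record
  { elem      = λ { zero → zero ; (suc a) → suc (elem a) }
  ; injective = λ { {zero}  {zero}  _  → refl
                  ; {suc _} {suc _} eq → cong suc (injective (suc-injective eq)) }
  ; sound     = λ { zero → here ; (suc a) → there (sound a) }
  ; complete  = λ { here        → zero , refl
                  ; (there i∈P) → let a , eq = complete i∈P in suc a , cong suc eq }
  }
  where open Enumeration (enumerate P)

-- The base ray has to come first, since index 0 is reserved for the ray u₀ of the Bergman fan.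
enumerateFrom : ∀ {q} {P : Subset q} {i k} → i ∈ P → Enumeration P (suc k) →
                Σ[ E ∈ Enumeration P (suc k) ] Enumeration.elem E zero ≡ i
enumerateFrom i∈P E with z , refl ← Enumeration.complete E i∈P = record
  { elem      = elem ∘ fromZ
  ; injective = fromZ-injective ∘ injective
  ; sound     = λ a → sound (fromZ a)
  ; complete  = λ j∈P → let a , eq = complete j∈P ; b , eq′ = fromZ-surjective a
                        in b , trans (cong elem eq′) eq
  } , refl
  where
  open Enumeration E

  -- This permutation of positions moves `z`, the position of the chosen element, to the front and
  -- keeps the order of the others.
  fromZ : Fin _ → Fin _
  fromZ zero    = z
  fromZ (suc a) = punchIn z a

  fromZ-injective : Injective _≡_ _≡_ fromZ
  fromZ-injective {zero}  {zero}  _  = refl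
  fromZ-injective {zero}  {suc b} eq = contradiction (sym eq) (punchInᵢ≢i z b)
  fromZ-injective {suc a} {zero}  eq = contradiction eq (punchInᵢ≢i z a)
  fromZ-injective {suc a} {suc b} eq = cong suc (punchIn-injective z a b eq)

  fromZ-surjective : ∀ a → ∃ λ b → fromZ b ≡ a
  fromZ-surjective a with z ≟ a
  ... | yes refl = zero , refl
  ... | no z≢a   = suc (punchOut z≢a) , punchIn-punchOut z≢a

-- The standard Bergman fan

δ : ∀ {k} → Vector (Vector ℤ k) k
δ i t = if does (i ≟ t) then 1ℤ else 0ℤ

δ-diagonal : ∀ {k} (i : Fin k) → δ i i ≡ 1ℤ
δ-diagonal i = cong (if_then 1ℤ else 0ℤ) (dec-true (i ≟ i) refl)

δ-offDiagonal : ∀ {k} {i t : Fin k} → i ≢ t → δ i t ≡ 0ℤ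
δ-offDiagonal {i = i} {t} i≢t = cong (if_then 1ℤ else 0ℤ) (dec-false (i ≟ t) i≢t)

combination-δ : ∀ {k} (c : Vector ℤ k) → combination c δ ≗ c
combination-δ c t = begin
  ∑ℤ (λ i → c i ℤ.* δ i t)
    ≡⟨ sum-supported-at ℤ.+-0-commutativeMonoid _ t
         (λ i i≢t → trans (cong (c i ℤ.*_) (δ-offDiagonal i≢t)) (ℤ.*-zeroʳ (c i))) ⟩
  c t ℤ.* δ t t  ≡⟨ cong (c t ℤ.*_) (δ-diagonal t) ⟩
  c t ℤ.* 1ℤ     ≡⟨ ℤ.*-identityʳ (c t) ⟩
  c t            ∎
  where open ≡-Reasoning

δ-basis : ∀ {k} → IsBasis {k} δ
δ-basis = record
  { generates   = λ x → x , combination-δ x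
  ; independent = λ c c·δ≡0 t → trans (sym (combination-δ c t)) (c·δ≡0 t)
  }

bergmanRay : ∀ {k} → Fin (suc k) → Vector ℤ k
bergmanRay zero    t = -1ℤ
bergmanRay (suc i) t = δ i t

bergmanRay₀≡-∑ : ∀ {k} → bergmanRay {k} zero ≗ λ t → ℤ.- ∑ℤ (λ i → δ i t)
bergmanRay₀≡-∑ t = cong ℤ.-_ (sym (trans
  (∑ℤ.sum-cong-≗ λ i → sym (ℤ.*-identityˡ (δ i t))) (combination-δ (λ _ → 1ℤ) t)))

bergmanRay-primitive : ∀ {k} (b : Fin (suc (suc k))) → Primitive (bergmanRay b)
bergmanRay-primitive zero    d d∣ = ∣1⇒≡1 (d∣ zero)
bergmanRay-primitive (suc i) d d∣ =
  ∣1⇒≡1 (subst (λ x → d ∣ ℤ.∣ x ∣) (δ-diagonal i) (d∣ i))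

bergmanRay-nonzero : ∀ {k} (b : Fin (suc (suc k))) → ¬ IsZero (bergmanRay b)
bergmanRay-nonzero zero    ≡0 with () ← ≡0 zero
bergmanRay-nonzero (suc i) ≡0 with () ← trans (sym (δ-diagonal i)) (≡0 i)

-- Positive multiples preserve the signs of coordinates. At the coordinate of a standard basis
-- vector, that vector is positive, ray 0 is negative and the other basis vectors vanish.
bergmanRay-distinct : ∀ {k} (b b′ : Fin (suc k)) → b ≢ b′ → ¬ SameRay (bergmanRay b) (bergmanRay b′)
bergmanRay-distinct zero    zero     b≢b′ _ = b≢b′ refl
bergmanRay-distinct zero    (suc j)  _ (m , m′ , eq)
  with () ← trans (eq j) (cong (+ suc m′ ℤ.*_) (δ-diagonal j))
bergmanRay-distinct (suc i) zero     _ (m , m′ , eq)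
  with () ← trans (sym (cong (+ suc m ℤ.*_) (δ-diagonal i))) (eq i)
bergmanRay-distinct (suc i) (suc j) i≢j (m , m′ , eq)
  with () ← trans (trans (sym (cong (+ suc m ℤ.*_) (δ-diagonal i))) (eq i))
                  (trans (cong (+ suc m′ ℤ.*_) (δ-offDiagonal (i≢j ∘ cong suc ∘ sym)))
                         (ℤ.*-zeroʳ (+ suc m′)))

-- The dimension is `suc k` because in dimension 0 the ray of index 0 would be the zero vector,
-- which is not primitive.
bergmanFan : ∀ k → TropicalFan (suc k)
bergmanFan k = record
  { size        = suc (suc k)
  ; generator   = bergmanRay
  ; weight      = λ _ → 1
  ; isPrimitive = bergmanRay-primitive
  ; distinct    = bergmanRay-distinct
  ; positive    = λ _ → s≤s z≤n
  -- The standard basis vectors add up to (1,...,1), which cancels ray 0.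
  ; balanced    = λ t → cong (λ s → -1ℤ ℤ.+ s) (combination-δ (λ _ → 1ℤ) t)
  }

bergmanFan-isBergmanFan : ∀ k → IsBergmanFan (bergmanFan k)
bergmanFan-isBergmanFan k = record
  { dim-positive = s≤s z≤n
  ; u            = δ
  ; u-basis      = δ-basis
  ; index        = ↔-id _
  ; generator₀   = bergmanRay₀≡-∑
  ; generatorᵢ   = λ _ _ → refl
  ; unit-weights = λ _ → refl
  }

-- Push-forwards along a matching of rays

≗⇒sameRay : ∀ {n} {v w : Vector ℤ n} → v ≗ w → SameRay v w
≗⇒sameRay v≗w = 0 , 0 , λ t → cong (1ℤ ℤ.*_) (v≗w t)

-- Each ray of `G` receives just one ray of `F`, with factor 1, and all rays outside the image of
-- `ρ` are contracted. So every weight sum has a single nonzero term, 1 · 1.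
rayMatching⇒pushForward : ∀ {n k} {π : Vector ℤ n → Vector ℤ k} {F : TropicalFan n}
  (G : TropicalFan k) → (∀ b → ¬ IsZero (generator G b)) → (∀ b → weight G b ≡ 1) →
  (ρ : Fin (size G) → Fin (size F)) →
  (∀ b → weight F (ρ b) ≡ 1) →
  (∀ b → π (generator F (ρ b)) ≗ generator G b) →
  (∀ i → (∀ b → ρ b ≢ i) → IsZero (π (generator F i))) →
  IsPushForward π F G
rayMatching⇒pushForward {π = π} {F} G g≢0 ωG ρ ωF π-ρ π-off = record
  { ray-of-image = rayOfImage
  ; image-of-ray = λ b → ρ b
      , (λ ≡0 → g≢0 b λ t → trans (sym (π-ρ b t)) (≡0 t))
      , ≗⇒sameRay (λ t → sym (π-ρ b t))
  ; weights = λ b → mult b , multiplicity b , trans (ωG b) (sym (weightSum b))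
  }
  where
  v = generator F
  g = generator G

  rayOfImage : ∀ i → ¬ IsZero (π (v i)) → ∃ λ b → SameRay (g b) (π (v i))
  rayOfImage i πv≢0 with any? (λ b → ρ b ≟ i)
  ... | yes (b , refl) = b , ≗⇒sameRay (λ t → sym (π-ρ b t))
  ... | no  ∄b         = contradiction (π-off i λ b eq → ∄b (b , eq)) πv≢0

  mult : ∀ b → Vector ℕ (size F)
  mult b i = if does (ρ b ≟ i) then 1 else 0

  multiplicity : ∀ b i → Multiplicity (g b) (π (v i)) (mult b i)
  multiplicity b i with ρ b ≟ i
  -- The argument 0 of `on` stands for the factor 1.
  ... | yes refl = on 0 λ t → trans (π-ρ b t) (sym (ℤ.*-identityˡ _))
  ... | no ρb≢i  = off λ (m , πv≗mg) → notOnRay m πv≗mg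
    where
    -- Ray `i` is either matched with another ray of `G`, which is distinct from that of `g b`, or
    -- contracted, which would force `g b` to be zero.
    notOnRay : ∀ m → ¬ (π (v i) ≗ suc m · g b)
    notOnRay m πv≗mg with any? (λ b′ → ρ b′ ≟ i)
    ... | yes (b′ , refl) = distinct G b′ b (λ { refl → ρb≢i refl })
          (0 , m , λ t → trans (ℤ.*-identityˡ _) (trans (sym (π-ρ b′ t)) (πv≗mg t)))
    ... | no  ∄b′ = g≢0 b λ t → ℤ.*-cancelˡ-≡ (+ suc m) _ _
          (trans (sym (πv≗mg t)) (trans (π-off i (λ b′ eq → ∄b′ (b′ , eq)) t) (sym (ℤ.*-zeroʳ (+ suc m)))))

  weightSum : ∀ b → ∑ℕ (λ i → weight F i ℕ.* mult b i) ≡ 1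
  weightSum b = begin
    ∑ℕ (λ i → weight F i ℕ.* mult b i)
      ≡⟨ sum-supported-at ℕ.+-0-commutativeMonoid _ (ρ b) (λ i i≢ρb → trans
           (cong (λ d → weight F i ℕ.* (if d then 1 else 0)) (dec-false (ρ b ≟ i) (i≢ρb ∘ sym)))
           (ℕ.*-zeroʳ (weight F i))) ⟩
    weight F (ρ b) ℕ.* mult b (ρ b)
      ≡⟨ cong₂ ℕ._*_ (ωF b) (cong (if_then 1 else 0) (dec-true (ρ b ≟ ρ b) refl)) ⟩
    1 ∎
    where open ≡-Reasoning

-- The projection whose coordinates are gallery forms

module _ {n} (F : TropicalFan n) {k} {ρ : Fin (suc (suc k)) → Fin (size F)}
         (ρ-injective : Injective _≡_ _≡_ ρ)
         (l : Fin (suc k) → Vector ℤ n → ℤ)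
         (separates : ∀ a → Separates F (l a) (ρ (suc a)) (ρ zero)) where
  private
    module S a = Separates (separates a)

    π : Vector ℤ n → Vector ℤ (suc k)
    π x a = l a x

    π-ρ : ∀ b → π (generator F (ρ b)) ≗ bergmanRay b
    π-ρ zero    a = S.value₋ a
    π-ρ (suc b) a with b ≟ a
    ... | yes refl = S.value₊ a
    ... | no b≢a   = S.value₀ a (ρ (suc b))
                       (b≢a ∘ suc-injective ∘ ρ-injective)
                       (λ eq → contradiction (ρ-injective eq) λ ())

    ω-ρ : ∀ b → weight F (ρ b) ≡ 1
    -- Any of the forms gives the weight of the base ray; form `zero` exists because there are
    -- `suc k` of them.
    ω-ρ zero    = S.weight₋ zero
    ω-ρ (suc a) = S.weight₊ a

  separatingForms-pushForward : IsPushForward π F (bergmanFan k)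
  separatingForms-pushForward =
    rayMatching⇒pushForward (bergmanFan k) bergmanRay-nonzero (λ _ → refl) ρ ω-ρ π-ρ
      λ i i∉ρ a → S.value₀ a i (i∉ρ (suc a) ∘ sym) (i∉ρ zero ∘ sym)

lemma3p15 : ∀ (n : ℕ) (F : TropicalFan n) → Spanning F →
    ∀ (P : Subset (size F)) → IsGalleryClass F P →
    ∀ (k : ℕ) → 2 ≤ suc k → ∣ P ∣ ≡ suc k →
    Σ[ π ∈ (Vector ℤ n → Vector ℤ k) ] IsLinear π ×
    (Σ[ G ∈ TropicalFan k ] IsPushForward π F G × IsBergmanFan G)
lemma3p15 _ _ _ _ _ zero (s≤s ()) _
lemma3p15 n F _ P (i₀ , inP) (suc k) _ ∣P∣≡
  -- The class contains `i₀` by reflexivity, so its enumeration can start there; `refl` then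
  -- identifies `i₀` with `elem zero`.
  with E , refl ← enumerateFrom (from (inP i₀) (inj₁ refl)) (subst (Enumeration P) ∣P∣≡ (enumerate P))
  = (λ x a → proj₁ (form a) x)
  , linearForms⇒linear (proj₁ ∘ form) (proj₁ ∘ proj₂ ∘ form)
  , bergmanFan k
  , separatingForms-pushForward F injective (proj₁ ∘ form) (proj₂ ∘ proj₂ ∘ form)
  , bergmanFan-isBergmanFan k
  where
  open Enumeration E

  form : ∀ a → ∃ λ l → IsLinearForm l × Separates F l (elem (suc a)) (elem zero)
  -- Membership in the class relates `elem (suc a)` to the base ray. Injectivity rules out equality,
  -- so the two form a gallery.
  form a with to (inP (elem (suc a))) (sound (suc a))
  ... | inj₁ eq      = contradiction (injective eq) λ ()
  ... | inj₂ gallery = gallery⇒separates F gallery
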